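{- Let $n$ be a positive integer and let $\mathbb{F}_q$ be the finite field with $q$ elements. If $q\le n-2$, then the Catalan matroid $\mathbf{C}_n$ is not representable over $\mathbb{F}_q$.
   Context: A Dyck path of length $2n$ is a path in the plane from $(0,0)$ to $(2n,0)$, with steps $(1,1)$ (up-steps) and $(1,-1)$ (down-steps), that never passes below the $x$-axis. Its up-step set is the set of $i\in[2n]=\{1,\dots,2n\}$ for which the $i$-th step is an up-step. The Catalan matroid $\mathbf{C}_n$ is the matroid on the ground set $[2n]$ whose bases are the up-step sets of all Dyck paths of length $2n$. A matroid is representable over a field if it is isomorphic to the vector matroid of a finite indexed family of vectors in a vector space over that field. -}

module Defs where

open import Algebra.Bundles using (CommutativeRing)
import Algebra.Definitions
open import Algebra.Module.Bundles using (Module)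
import Algebra.Module.Properties
import Algebra.Properties.CommutativeMonoid.Sum
import Algebra.Properties.Ring
open import Data.Bool.Base using (if_then_else_)
open import Data.Empty using (⊥-elim)
open import Data.Fin.Base using (Fin; zero; suc)
import Data.Fin.Properties as Fin
open import Data.Fin.Subset using
  (Subset; inside; outside; ⊥; ⊤; ⁅_⁆; _∈_; _∉_; _⊆_; _∪_; _-_; _─_; ∣_∣)
open import Data.Fin.Subset.Properties
open import Data.Fin.Permutation using (Permutation; _⟨$⟩ˡ_)
open import Data.Nat.Base using (ℕ; zero; suc; _+_; _*_; _≤_; _<_; z≤n; s≤s; s≤s⁻¹)
open import Data.Nat.Properties hiding (_≟_)
open import Data.Nat.Solver using (module +-*-Solver)
open import Data.Product.Base using (Σ; ∃-syntax; _×_; _,_; proj₁; proj₂)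
open import Data.Sum.Base using (_⊎_; inj₁; inj₂)
open import Data.Unit.Base using (tt) renaming (⊤ to Unit)
open import Data.Vec.Base using ([]; _∷_; lookup; tabulate; here; there)
open import Function.Base using (_∘_)
open import Function.Bundles using (_⇔_; mk⇔; Inverse)
open import Level using (_⊔_) renaming (zero to 0ℓ; suc to lsuc)
import Relation.Binary.Reasoning.Setoid
open import Relation.Binary.PropositionalEquality
  using (_≡_; _≢_; refl; sym; trans; cong; subst; setoid)
open import Relation.Binary.Definitions using (Decidable)
open import Relation.Nullary using (¬_; yes; no; does; contradiction)
open import Relation.Nullary.Decidable using (decidable-stable; ¬?; _×-dec_)

MaximalIn : ∀ {n ℓ} → (Subset n → Set ℓ) → Subset n → Subset n → Set ℓ
MaximalIn I X A = A ⊆ X × I A × (∀ e → e ∈ X → e ∉ A → ¬ I (A ∪ ⁅ e ⁆))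

-- The independence augmentation axiom is used in its classically
-- equivalent form "all maximal independent subsets of a set X have the
-- same size": unlike augmentation, it holds constructively for linear
-- independence in a vector space whose equality is not decidable.

record Matroid (n : ℕ) ℓ : Set (lsuc ℓ) where
  field
    Independent   : Subset n → Set ℓ
    independent-⊥ : Independent ⊥
    independent-⊆ : ∀ {A B} → A ⊆ B → Independent B → Independent A
    equicardinal  : ∀ X {A B} → MaximalIn Independent X A →
                    MaximalIn Independent X B → ∣ A ∣ ≡ ∣ B ∣

  Basis : Subset n → Set ℓ
  Basis = MaximalIn Independent ⊤

image : ∀ {m n} → Permutation m n → Subset m → Subset n
image σ S = tabulate (λ j → lookup S (σ ⟨$⟩ˡ j))

record _≅_ {m n ℓ₁ ℓ₂} (M : Matroid m ℓ₁) (N : Matroid n ℓ₂) : Set (ℓ₁ ⊔ ℓ₂) where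
  field
    bijection    : Permutation m n
    independent⇔ : ∀ S → Matroid.Independent M S ⇔
                         Matroid.Independent N (image bijection S)

-- The library's HeytingField admits the zero ring, hence this definition.
-- Decidable equality is no restriction for a field with finitely many
-- elements: it follows from HasOrder.

record Field c ℓ : Set (lsuc (c ⊔ ℓ)) where
  field
    commutativeRing : CommutativeRing c ℓ

  open CommutativeRing commutativeRing using (_≈_; _≉_; 0#; 1#) renaming (_*_ to _·_)
  open Algebra.Definitions _≈_ using (Invertible)

  field
    _≟_        : Decidable _≈_
    1≉0        : 1# ≉ 0#
    invertible : ∀ x → x ≉ 0# → Invertible 1# _·_ x

HasOrder : ∀ {c ℓ} → Field c ℓ → ℕ → Set (c ⊔ ℓ)
HasOrder F q = Inverse (CommutativeRing.setoid (Field.commutativeRing F)) (setoid (Fin q))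

VectorSpace : ∀ {c ℓ} → Field c ℓ → ∀ μ ν → Set (c ⊔ ℓ ⊔ lsuc (μ ⊔ ν))
VectorSpace F = Module (Field.commutativeRing F)

∣p∪⁅x⁆∣≤ : ∀ {n} (p : Subset n) x → ∣ p ∪ ⁅ x ⁆ ∣ ≤ suc ∣ p ∣
∣p∪⁅x⁆∣≤ (inside  ∷ p) zero    = s≤s (≤-trans (≤-reflexive (cong ∣_∣ (∪-identityʳ p))) (n≤1+n _))
∣p∪⁅x⁆∣≤ (outside ∷ p) zero    = s≤s (≤-reflexive (cong ∣_∣ (∪-identityʳ p)))
∣p∪⁅x⁆∣≤ (inside  ∷ p) (suc x) = s≤s (∣p∪⁅x⁆∣≤ p x)
∣p∪⁅x⁆∣≤ (outside ∷ p) (suc x) = ∣p∪⁅x⁆∣≤ p x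

x∉p-x : ∀ {n} (p : Subset n) x → x ∉ p - x
x∉p-x (inside  ∷ p) zero ()
x∉p-x (outside ∷ p) zero ()
x∉p-x (_ ∷ p) (suc x) (there x∈) = x∉p-x p x x∈

x∈p─q⇒x∉q : ∀ {n} (p q : Subset n) {x} → x ∈ p ─ q → x ∉ q
x∈p─q⇒x∉q (_ ∷ p) (_ ∷ q) (there x∈) (there x∈q) = x∈p─q⇒x∉q p q x∈ x∈q
x∈p─q⇒x∉q (inside ∷ p) (inside ∷ q) () here
x∈p─q⇒x∉q (outside ∷ p) (inside ∷ q) () here

¬¬-Fin : ∀ {n ℓ} {P : Fin n → Set ℓ} → (∀ i → ¬ ¬ P i) → ¬ ¬ (∀ i → P i)
¬¬-Fin {zero}  _ k = k λ ()
¬¬-Fin {suc n} f k = f zero λ p₀ → ¬¬-Fin (f ∘ suc) λ p →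
  k λ { zero → p₀ ; (suc i) → p i }

module _ {c ℓ μ ν} (F : Field c ℓ) (V : VectorSpace F μ ν) {m : ℕ}
         (v : Fin m → Module.Carrierᴹ V) where

  open Field F
  open CommutativeRing commutativeRing
    using (Carrier; _≈_; _≉_; 0#; 1#)
    renaming (_+_ to _⊕_; _*_ to _·_; -_ to ⊖_)
  private
    module R = CommutativeRing commutativeRing
  open Module V
  open Algebra.Properties.CommutativeMonoid.Sum +ᴹ-commutativeMonoid
    using (sum; sum-cong-≋; ∑-distrib-+; sum-replicate-zero)

  SupportedOn : Subset m → (Fin m → Carrier) → Set ℓ
  SupportedOn S x = ∀ i → i ∉ S → x i ≈ 0#

  combination : (Fin m → Carrier) → Carrierᴹ
  combination x = sum (λ i → x i *ₗ v i)

  -- Independence of the indexed subfamily (v i), i ∈ S, so that for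
  -- instance repeated vectors are dependent.
  LinearlyIndependent : Subset m → Set (c ⊔ ℓ ⊔ ν)
  LinearlyIndependent S =
    ∀ x → SupportedOn S x → combination x ≈ᴹ 0ᴹ → ∀ i → x i ≈ 0#

  open Algebra.Module.Properties V using (x≈0⇒x*y≈0)
  open Algebra.Properties.Ring R.ring using (-0#≈0#; -‿distribˡ-*; -‿involutive)
  private
    module ≈-R = Relation.Binary.Reasoning.Setoid R.setoid
    module ≈-M = Relation.Binary.Reasoning.Setoid ≈ᴹ-setoid
    LI = LinearlyIndependent

  Span : Subset m → Carrierᴹ → Set _
  Span S w = ∃[ x ] SupportedOn S x × w ≈ᴹ combination x

  δ : ∀ {k} → Fin k → Fin k → Carrier
  δ i j = if does (i Fin.≟ j) then 1# else 0#

  δ-≡ : ∀ {k} (i : Fin k) → δ i i ≈ 1#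
  δ-≡ i with i Fin.≟ i
  ... | yes _ = R.refl
  ... | no i≢i = contradiction refl i≢i

  δ-≢ : ∀ {k} {i j : Fin k} → i ≢ j → δ i j ≈ 0#
  δ-≢ {i = i} {j} i≢j with i Fin.≟ j
  ... | yes i≡j = contradiction i≡j i≢j
  ... | no _ = R.refl

  sum-zero : ∀ {k} (w : Fin k → Carrierᴹ) → (∀ i → w i ≈ᴹ 0ᴹ) → sum w ≈ᴹ 0ᴹ
  sum-zero {k} w w≈0 = ≈ᴹ-trans (sum-cong-≋ w≈0) (sum-replicate-zero k)

  sum-δ : ∀ {k} (w : Fin k → Carrierᴹ) i → sum (λ j → δ i j *ₗ w j) ≈ᴹ w i
  sum-δ w zero = ≈ᴹ-trans
    (+ᴹ-cong (*ₗ-identityˡ _) (sum-zero (λ j → 0# *ₗ w (suc j)) λ j → *ₗ-zeroˡ _)) (+ᴹ-identityʳ _)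
  sum-δ w (suc i) = ≈ᴹ-trans
    (+ᴹ-cong (*ₗ-zeroˡ _) (≈ᴹ-trans (sum-cong-≋ step) (sum-δ (w ∘ suc) i))) (+ᴹ-identityˡ _)
    where
    step : ∀ j → δ (suc i) (suc j) *ₗ w (suc j) ≈ᴹ δ i j *ₗ w (suc j)
    step j with i Fin.≟ j
    ... | yes _ = ≈ᴹ-refl
    ... | no  _ = ≈ᴹ-refl

  sum-scale : ∀ {k} r (w : Fin k → Carrierᴹ) → sum (λ j → r *ₗ w j) ≈ᴹ r *ₗ sum w
  sum-scale {zero}  r w = ≈ᴹ-sym (*ₗ-zeroʳ r)
  sum-scale {suc k} r w = ≈ᴹ-trans
    (+ᴹ-cong ≈ᴹ-refl (sum-scale r (w ∘ suc))) (≈ᴹ-sym (*ₗ-distribˡ r _ _))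

  combination-+ : ∀ x y → combination (λ i → x i ⊕ y i) ≈ᴹ combination x +ᴹ combination y
  combination-+ x y = ≈ᴹ-trans
    (sum-cong-≋ λ i → *ₗ-distribʳ (v i) (x i) (y i)) (∑-distrib-+ (λ i → x i *ₗ v i) (λ i → y i *ₗ v i))

  combination-* : ∀ r x → combination (λ i → r · x i) ≈ᴹ r *ₗ combination x
  combination-* r x = ≈ᴹ-trans
    (sum-cong-≋ λ i → *ₗ-assoc r (x i) (v i)) (sum-scale r (λ i → x i *ₗ v i))

  span-≈ : ∀ {S u w} → u ≈ᴹ w → Span S u → Span S w
  span-≈ u≈w (x , s , e) = x , s , ≈ᴹ-trans (≈ᴹ-sym u≈w) e

  span-0 : ∀ {S} → Span S 0ᴹ
  span-0 = (λ _ → 0#) , (λ _ _ → R.refl) , ≈ᴹ-sym (sum-zero (λ i → 0# *ₗ v i) λ i → *ₗ-zeroˡ _)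

  span-+ : ∀ {S u w} → Span S u → Span S w → Span S (u +ᴹ w)
  span-+ (x , s , e) (y , t , f) =
    (λ i → x i ⊕ y i) ,
    (λ i i∉S → R.trans (R.+-cong (s i i∉S) (t i i∉S)) (R.+-identityˡ _)) ,
    ≈ᴹ-trans (+ᴹ-cong e f) (≈ᴹ-sym (combination-+ x y))

  span-* : ∀ {S w} r → Span S w → Span S (r *ₗ w)
  span-* r (x , s , e) =
    (λ i → r · x i) ,
    (λ i i∉S → R.trans (R.*-congˡ (s i i∉S)) (R.zeroʳ r)) ,
    ≈ᴹ-trans (*ₗ-congˡ e) (≈ᴹ-sym (combination-* r x))

  span-v : ∀ {S} i → i ∈ S → Span S (v i)
  span-v {S} i i∈S =
    δ i ,
    (λ j j∉S → δ-≢ λ i≡j → j∉S (subst (_∈ S) i≡j i∈S)) ,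
    ≈ᴹ-sym (sum-δ v i)

  span-sum : ∀ {S k} (w : Fin k → Carrierᴹ) → (∀ i → Span S (w i)) → Span S (sum w)
  span-sum {k = zero}  w s = span-0
  span-sum {k = suc k} w s = span-+ (s zero) (span-sum (w ∘ suc) (s ∘ suc))

  span-trans : ∀ {S T w} → (∀ i → i ∈ S → Span T (v i)) → Span S w → Span T w
  span-trans {S} {T} S⊆T (x , s , e) = span-≈ (≈ᴹ-sym e) (span-sum _ term)
    where
    term : ∀ i → Span T (x i *ₗ v i)
    term i with i ∈? S
    ... | yes i∈S = span-* (x i) (S⊆T i i∈S)
    ... | no  i∉S = span-≈ (≈ᴹ-sym (x≈0⇒x*y≈0 (s i i∉S))) span-0

  solve-for : ∀ {S} x i → SupportedOn S x → combination x ≈ᴹ 0ᴹ → x i ≉ 0# → Span (S - i) (v i)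
  solve-for {S} x i s e xᵢ≉0 = y , supp , ≈ᴹ-sym total
    where
    r = proj₁ (invertible (x i) xᵢ≉0)
    rx≈1 = proj₁ (proj₂ (invertible (x i) xᵢ≉0))
    y : Fin m → Carrier
    y j = (⊖ r) · x j ⊕ δ i j
    supp : SupportedOn (S - i) y
    supp j j∉ with i Fin.≟ j
    ... | yes refl = begin
      (⊖ r) · x i ⊕ 1#   ≈⟨ R.+-congʳ (R.sym (-‿distribˡ-* r (x i))) ⟩
      ⊖ (r · x i) ⊕ 1#   ≈⟨ R.+-congʳ (R.-‿cong rx≈1) ⟩
      ⊖ 1# ⊕ 1#          ≈⟨ R.-‿inverseˡ 1# ⟩
      0#                 ∎
      where open ≈-R
    ... | no i≢j = begin
      (⊖ r) · x j ⊕ 0#   ≈⟨ R.+-identityʳ _ ⟩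
      (⊖ r) · x j        ≈⟨ R.*-congˡ (s j λ j∈S → j∉ (x∈p∧x≢y⇒x∈p-y j∈S (i≢j ∘ sym))) ⟩
      (⊖ r) · 0#         ≈⟨ R.zeroʳ _ ⟩
      0#                 ∎
      where open ≈-R
    total : combination y ≈ᴹ v i
    total = begin
      combination y                                        ≈⟨ combination-+ _ _ ⟩
      combination (λ j → (⊖ r) · x j) +ᴹ combination (δ i) ≈⟨ +ᴹ-cong (combination-* _ x) (sum-δ v i) ⟩
      (⊖ r) *ₗ combination x +ᴹ v i                        ≈⟨ +ᴹ-cong (*ₗ-congˡ e) ≈ᴹ-refl ⟩
      (⊖ r) *ₗ 0ᴹ +ᴹ v i                                   ≈⟨ +ᴹ-cong (*ₗ-zeroʳ _) ≈ᴹ-refl ⟩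
      0ᴹ +ᴹ v i                                            ≈⟨ +ᴹ-identityˡ _ ⟩
      v i                                                  ∎
      where open ≈-M

  ∉-∪-⁅⁆ : ∀ {S : Subset m} {i e} → i ∉ S → i ≢ e → i ∉ S ∪ ⁅ e ⁆
  ∉-∪-⁅⁆ {S} {i} {e} i∉S i≢e i∈ with x∈p∪q⁻ S ⁅ e ⁆ i∈
  ... | inj₁ i∈S = i∉S i∈S
  ... | inj₂ i∈e = i≢e (x∈⁅y⁆⇒x≡y e i∈e)

  li-⊆ : ∀ {A B} → A ⊆ B → LI B → LI A
  li-⊆ A⊆B li x s = li x λ i i∉B → s i (i∉B ∘ A⊆B)

  span-∪ : ∀ {A} e x → SupportedOn (A ∪ ⁅ e ⁆) x → combination x ≈ᴹ 0ᴹ → x e ≉ 0# → Span A (v e)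
  span-∪ {A} e x s rel xₑ≉0 = span-trans sub (solve-for x e s rel xₑ≉0)
    where
    sub : ∀ i → i ∈ (A ∪ ⁅ e ⁆) - e → Span A (v i)
    sub i i∈ with i ∈? A
    ... | yes i∈A = span-v i i∈A
    ... | no  i∉A with i Fin.≟ e
    ...   | yes refl = contradiction i∈ (x∉p-x (A ∪ ⁅ e ⁆) e)
    ...   | no  i≢e  = contradiction (p─q⊆p _ _ i∈) (∉-∪-⁅⁆ i∉A i≢e)

  dependent⇒span : ∀ {A} e → LI A → ¬ LI (A ∪ ⁅ e ⁆) → ¬ ¬ Span A (v e)
  dependent⇒span {A} e li ¬li ¬span = ¬li li-∪
    where
    li-∪ : LI (A ∪ ⁅ e ⁆)
    li-∪ x s rel with x e ≟ 0#
    ... | no  xₑ≉0 = contradiction (span-∪ e x s rel xₑ≉0) ¬span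
    ... | yes xₑ≈0 = li x s-A rel
      where
      s-A : SupportedOn A x
      s-A i i∉A with i Fin.≟ e
      ... | yes refl = xₑ≈0
      ... | no  i≢e  = s i (∉-∪-⁅⁆ i∉A i≢e)

  relation : ∀ i (x : Fin m → Carrier) → v i ≈ᴹ combination x →
             combination (λ j → x j ⊕ (⊖ 1#) · δ i j) ≈ᴹ 0ᴹ
  relation i x e = begin
    combination (λ j → x j ⊕ (⊖ 1#) · δ i j)               ≈⟨ combination-+ _ _ ⟩
    combination x +ᴹ combination (λ j → (⊖ 1#) · δ i j)    ≈⟨ +ᴹ-cong (≈ᴹ-sym e) (combination-* _ _) ⟩
    v i +ᴹ (⊖ 1#) *ₗ combination (δ i)                     ≈⟨ +ᴹ-cong (≈ᴹ-sym (*ₗ-identityˡ _)) (*ₗ-congˡ (sum-δ v i)) ⟩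
    1# *ₗ v i +ᴹ (⊖ 1#) *ₗ v i                             ≈⟨ *ₗ-distribʳ _ _ _ ⟨
    (1# ⊕ ⊖ 1#) *ₗ v i                                     ≈⟨ *ₗ-congʳ (R.-‿inverseʳ 1#) ⟩
    0# *ₗ v i                                              ≈⟨ *ₗ-zeroˡ _ ⟩
    0ᴹ                                                     ∎
    where open ≈-M

  exchange : ∀ {A B b} → LI B → b ∈ B → b ∉ A → Span A (v b) →
             ∃[ a ] a ∈ A × a ∉ B × Span ((A ∪ ⁅ b ⁆) - a) (v a)
  exchange {A} {B} {b} li b∈B b∉A (x , s , e) with
    Fin.any? (λ a → ¬? (a ∈? B) ×-dec ¬? (x a ≟ 0#))
  ... | yes (a , a∉B , xₐ≉0) = a , a∈A , a∉B , solve-for y a supp (relation b x e) yₐ≉0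
    where
    y : Fin m → Carrier
    y j = x j ⊕ (⊖ 1#) · δ b j
    y≈x : ∀ {j} → b ≢ j → y j ≈ x j
    y≈x b≢j = R.trans (R.+-congˡ (R.trans (R.*-congˡ (δ-≢ b≢j)) (R.zeroʳ _))) (R.+-identityʳ _)
    a∈A = decidable-stable (a ∈? A) λ a∉A → xₐ≉0 (s a a∉A)
    yₐ≉0 : y a ≉ 0#
    yₐ≉0 yₐ≈0 = xₐ≉0 (R.trans (R.sym (y≈x λ b≡a → a∉B (subst (_∈ B) b≡a b∈B))) yₐ≈0)
    supp : SupportedOn (A ∪ ⁅ b ⁆) y
    supp j j∉ = R.trans
      (y≈x λ b≡j → j∉ (subst (_∈ A ∪ ⁅ b ⁆) b≡j (x∈p∪q⁺ (inj₂ (x∈⁅x⁆ b)))))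
      (s j λ j∈A → j∉ (x∈p∪q⁺ (inj₁ j∈A)))
  ... | no none = contradiction (R.trans (R.sym 1≈-y) (R.trans (R.-‿cong y_b≈0) -0#≈0#)) 1≉0
    where
    y : Fin m → Carrier
    y j = x j ⊕ (⊖ 1#) · δ b j
    supp : SupportedOn B y
    supp j j∉B = R.trans
      (R.+-cong
        (decidable-stable (x j ≟ 0#) λ xⱼ≉0 → none (j , j∉B , xⱼ≉0))
        (R.trans (R.*-congˡ (δ-≢ λ b≡j → j∉B (subst (_∈ B) b≡j b∈B))) (R.zeroʳ _)))
      (R.+-identityˡ 0#)
    y_b≈0 : y b ≈ 0#
    y_b≈0 = li y supp (relation b x e) b
    1≈-y : ⊖ (y b) ≈ 1#
    1≈-y = begin
      ⊖ (x b ⊕ (⊖ 1#) · δ b b) ≈⟨ R.-‿cong (R.+-cong (s b b∉A) (R.*-congˡ (δ-≡ b))) ⟩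
      ⊖ (0# ⊕ (⊖ 1#) · 1#)     ≈⟨ R.-‿cong (R.+-identityˡ _) ⟩
      ⊖ ((⊖ 1#) · 1#)          ≈⟨ R.-‿cong (R.*-identityʳ _) ⟩
      ⊖ (⊖ 1#)                 ≈⟨ -‿involutive 1# ⟩
      1#                       ∎
      where open ≈-R

  steinitz : ∀ k {A B} → ∣ B ─ A ∣ ≤ k → LI B → (∀ i → i ∈ B → Span A (v i)) → ∣ B ∣ ≤ ∣ A ∣
  steinitz k {A} {B} ≤k li B⊆A with nonempty? (B ─ A)
  ... | no empty = p⊆q⇒∣p∣≤∣q∣ λ {i} i∈B →
    decidable-stable (i ∈? A) λ i∉A → empty (i , x∈p∧x∉q⇒x∈p─q i∈B i∉A)
  ... | yes (b , b∈B─A) = step k ≤k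
    where
    b∈B = p─q⊆p B A b∈B─A
    b∉A = x∈p─q⇒x∉q B A b∈B─A
    ex  = exchange li b∈B b∉A (B⊆A b b∈B)
    a   = proj₁ ex
    a∈A = proj₁ (proj₂ ex)
    a∉B = proj₁ (proj₂ (proj₂ ex))
    A′  = (A ∪ ⁅ b ⁆) - a
    b∈A′ : b ∈ A′
    b∈A′ = x∈p∧x≢y⇒x∈p-y (x∈p∪q⁺ (inj₂ (x∈⁅x⁆ b))) λ b≡a → a∉B (subst (_∈ B) b≡a b∈B)
    A⊆A′ : ∀ i → i ∈ A → Span A′ (v i)
    A⊆A′ i i∈A with i Fin.≟ a
    ... | yes refl = proj₂ (proj₂ (proj₂ ex))
    ... | no  i≢a  = span-v i (x∈p∧x≢y⇒x∈p-y (x∈p∪q⁺ (inj₁ i∈A)) i≢a)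
    fewer : ∣ B ─ A′ ∣ < ∣ B ─ A ∣
    fewer = p⊂q⇒∣p∣<∣q∣
      ( (λ {i} i∈ → x∈p∧x∉q⇒x∈p─q (p─q⊆p B A′ i∈) λ i∈A → x∈p─q⇒x∉q B A′ i∈
          (x∈p∧x≢y⇒x∈p-y (x∈p∪q⁺ (inj₁ i∈A)) λ i≡a → a∉B (subst (_∈ B) i≡a (p─q⊆p B A′ i∈))))
      , b , b∈B─A , λ b∈ → x∈p─q⇒x∉q B A′ b∈ b∈A′ )
    A′≤A : ∣ A′ ∣ ≤ ∣ A ∣
    A′≤A = s≤s⁻¹ (≤-trans (x∈p⇒∣p-x∣<∣p∣ (x∈p∪q⁺ (inj₁ a∈A))) (∣p∪⁅x⁆∣≤ A b))
    step : ∀ k → ∣ B ─ A ∣ ≤ k → ∣ B ∣ ≤ ∣ A ∣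
    step zero    ≤0 = contradiction (≤-trans fewer ≤0) λ ()
    step (suc k) ≤k = ≤-trans
      (steinitz k (s≤s⁻¹ (≤-trans fewer ≤k)) li λ i i∈B → span-trans A⊆A′ (B⊆A i i∈B)) A′≤A

  maximal-≤ : ∀ {X A B} → MaximalIn LI X A → MaximalIn LI X B → ∣ B ∣ ≤ ∣ A ∣
  maximal-≤ {X} {A} {B} (_ , liA , maxA) (B⊆X , liB , _) = decidable-stable (∣ B ∣ ≤? ∣ A ∣) λ ≰ →
    ¬¬-Fin spanned λ f → ≰ (steinitz _ ≤-refl liB f)
    where
    spanned : ∀ i → ¬ ¬ (i ∈ B → Span A (v i))
    spanned i k with i ∈? B
    ... | no i∉B = k λ i∈B → contradiction i∈B i∉B
    ... | yes i∈B with i ∈? A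
    ...   | yes i∈A = k λ _ → span-v i i∈A
    ...   | no  i∉A = dependent⇒span i liA (maxA i (B⊆X i∈B) i∉A) λ sp → k λ _ → sp

  vectorMatroid : Matroid m (c ⊔ ℓ ⊔ ν)
  vectorMatroid = record
    { Independent   = LinearlyIndependent
    ; independent-⊥ = λ x s _ i → s i ∉⊥
    ; independent-⊆ = li-⊆
    ; equicardinal  = λ X maxA maxB → ≤-antisym (maximal-≤ maxB maxA) (maximal-≤ maxA maxB)
    }

Representable : ∀ {c ℓ n ℓ′} μ ν → Field c ℓ → Matroid n ℓ′ → Set (c ⊔ ℓ ⊔ ℓ′ ⊔ lsuc (μ ⊔ ν))
Representable μ ν F M =
  Σ (VectorSpace F μ ν) λ V → ∃[ m ] Σ (Fin m → Module.Carrierᴹ V) λ v → M ≅ vectorMatroid F V v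

-- PathFrom h k: a path with k steps from height h to height 0; since
-- heights are natural numbers it never passes below the axis.
data PathFrom : ℕ → ℕ → Set where
  end  : PathFrom 0 0
  up   : ∀ {h k} → PathFrom (suc h) k → PathFrom h (suc k)
  down : ∀ {h k} → PathFrom h k → PathFrom (suc h) (suc k)

DyckPath : ℕ → Set
DyckPath n = PathFrom 0 (2 * n)

-- The i-th step, i ∈ {1,…,2n}, is represented by the j : Fin (2 * n) with
-- toℕ j = i - 1.
upSteps : ∀ {h k} → PathFrom h k → Subset k
upSteps end      = []
upSteps (up P)   = inside  ∷ upSteps P
upSteps (down P) = outside ∷ upSteps P

-- At most half of the elements of each suffix are in the subset; for
-- subsets of [2n] this characterises independence in the Catalan matroid.
Sparse : ∀ {k} → Subset k → Set
Sparse []            = Unit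
Sparse {suc k} (s ∷ S) = 2 * ∣ s ∷ S ∣ ≤ suc k × Sparse S

sparse-⊆ : ∀ {k} {A B : Subset k} → A ⊆ B → Sparse B → Sparse A
sparse-⊆ {A = []}    {[]}    _   _       = tt
sparse-⊆ {A = _ ∷ _} {_ ∷ _} A⊆B (h , t) =
  ≤-trans (*-monoʳ-≤ 2 (p⊆q⇒∣p∣≤∣q∣ A⊆B)) h , sparse-⊆ (drop-∷-⊆ A⊆B) t

up-shift : ∀ h j → h + 2 * suc j ≡ suc (suc h + 2 * j)
up-shift = solve 2 (λ h j → h :+ con 2 :* (con 1 :+ j) := con 1 :+ (con 1 :+ h :+ con 2 :* j)) refl
  where open +-*-Solver

upSteps-count : ∀ {h k} (P : PathFrom h k) → h + 2 * ∣ upSteps P ∣ ≡ k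
upSteps-count end = refl
upSteps-count {h} (up P) = trans (up-shift h ∣ upSteps P ∣) (cong suc (upSteps-count P))
upSteps-count (down P) = cong suc (upSteps-count P)

upSteps-sparse : ∀ {h k} (P : PathFrom h k) → Sparse (upSteps P)
upSteps-sparse end = tt
upSteps-sparse {h} P@(up P′) =
  ≤-trans (m≤n+m _ h) (≤-reflexive (upSteps-count P)) , upSteps-sparse P′
upSteps-sparse {h} P@(down P′) =
  ≤-trans (m≤n+m _ h) (≤-reflexive (upSteps-count P)) , upSteps-sparse P′

up-eq : ∀ h j {k} → h + 2 * suc j ≡ suc k → suc h + 2 * j ≡ k
up-eq h j e = suc-injective (trans (sym (up-shift h j)) e)

extend : ∀ {k} (S : Subset k) h j → h + 2 * j ≡ k → ∣ S ∣ ≤ j → Sparse S →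
         ∃[ P ] S ⊆ upSteps {h} {k} P
extend [] zero zero refl _ _ = end , λ x → x
extend (inside ∷ S) h (suc j) e (s≤s le) (_ , sp) =
  let P , S⊆ = extend S (suc h) j (up-eq h j e) le sp in up P , in⊆in S⊆
extend (outside ∷ S) (suc h) zero e le (_ , sp) =
  let P , S⊆ = extend S h zero (suc-injective e) le sp in down P , out⊆ S⊆
extend (outside ∷ S) h (suc j) e le (_ , sp) with ∣ S ∣ ≤? j
... | yes le′ = let P , S⊆ = extend S (suc h) j (up-eq h j e) le′ sp in up P , out⊆ S⊆
extend (outside ∷ S) (suc h) (suc j) e le (_ , sp) | no _ =
  let P , S⊆ = extend S h (suc j) (suc-injective e) le sp in down P , out⊆ S⊆
extend {suc k} (outside ∷ S) zero (suc j) e le (_ , sp) | no ≰ =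
  contradiction (≤-trans (≤-reflexive (sym e)) (≤-trans (*-monoʳ-≤ 2 (≰⇒> ≰)) (bound S sp))) 1+n≰n
  where
  bound : ∀ {k} (S : Subset k) → Sparse S → 2 * ∣ S ∣ ≤ k
  bound []      _       = z≤n
  bound (_ ∷ _) (h , _) = h

augment : ∀ {k} {A B : Subset k} → Sparse A → Sparse B → ∣ A ∣ < ∣ B ∣ →
          ∃[ e ] e ∈ B × e ∉ A × Sparse (A ∪ ⁅ e ⁆)
augment {A = []} {[]} _ _ ()
augment {A = x ∷ A} {y ∷ B} (hA , spA) (hB , spB) lt with ∣ A ∣ <? ∣ B ∣
... | yes lt′ = let e , e∈B , e∉A , sp = augment spA spB lt′ in
  suc e , there e∈B , (λ { (there e∈A) → e∉A e∈A }) ,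
  (≤-trans (*-monoʳ-≤ 2 (≤-trans (∣p∪⁅x⁆∣≤ (x ∷ A) (suc e)) lt)) hB , sp)
augment {A = outside ∷ A} {inside ∷ B} (hA , spA) (hB , spB) lt | no ≮ =
  zero , here , (λ ()) ,
  (≤-trans (*-monoʳ-≤ 2 (≤-trans (∣p∪⁅x⁆∣≤ (outside ∷ A) zero) lt)) hB , subst Sparse (sym (∪-identityʳ A)) spA)
augment {A = outside ∷ A} {outside ∷ B} _ _ lt | no ≮ = contradiction lt ≮
augment {A = inside ∷ A} {inside ∷ B} _ _ lt | no ≮ = contradiction (s≤s⁻¹ lt) ≮
augment {A = inside ∷ A} {outside ∷ B} _ _ lt | no ≮ = contradiction (<-trans (n<1+n _) lt) ≮

CatalanIndependent : ∀ n → Subset (2 * n) → Set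
CatalanIndependent n S = Σ (DyckPath n) λ P → S ⊆ upSteps P

upSteps-size : ∀ n (P : DyckPath n) → ∣ upSteps P ∣ ≡ n
upSteps-size n P = *-cancelˡ-≡ ∣ upSteps P ∣ n 2 (upSteps-count P)

catalan-sparse : ∀ n {S} → CatalanIndependent n S → Sparse S
catalan-sparse n (P , S⊆) = sparse-⊆ S⊆ (upSteps-sparse P)

catalan-⊆ : ∀ n {A B} → A ⊆ B → CatalanIndependent n B → CatalanIndependent n A
catalan-⊆ n A⊆B (P , B⊆) = P , λ x → B⊆ (A⊆B x)

maximal-≥ : ∀ n {X A B} → MaximalIn (CatalanIndependent n) X A →
            MaximalIn (CatalanIndependent n) X B → ∣ B ∣ ≤ ∣ A ∣
maximal-≥ n {X} {A} {B} (A⊆X , iA , maxA) (B⊆X , iB@(Q , B⊆) , _) = ≮⇒≥ λ lt →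
  let e , e∈B , e∉A , sp = augment (catalan-sparse n iA) (catalan-sparse n iB) lt
      size = ≤-trans (≤-trans (∣p∪⁅x⁆∣≤ A e) lt)
               (≤-trans (p⊆q⇒∣p∣≤∣q∣ B⊆) (≤-reflexive (upSteps-size n Q)))
  in maxA e (B⊆X e∈B) e∉A (extend (A ∪ ⁅ e ⁆) 0 n refl size sp)

catalan : ∀ n → Matroid (2 * n) 0ℓ
catalan n = record
  { Independent   = CatalanIndependent n
  ; independent-⊥ = extend ⊥ 0 n refl (≤-trans (≤-reflexive (∣⊥∣≡0 (2 * n))) z≤n) (sparse-⊥ (2 * n))
  ; independent-⊆ = catalan-⊆ n
  ; equicardinal  = λ X maxA maxB → ≤-antisym (maximal-≥ n maxB maxA) (maximal-≥ n maxA maxB)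
  }
  where
  sparse-⊥ : ∀ k → Sparse {k} ⊥
  sparse-⊥ zero    = tt
  sparse-⊥ (suc k) = ≤-trans (≤-reflexive (cong (2 *_) (∣⊥∣≡0 (suc k)))) z≤n , sparse-⊥ k

catalan-bases : ∀ n S → Matroid.Basis (catalan n) S ⇔ (Σ (DyckPath n) λ P → S ≡ upSteps P)
catalan-bases n S = mk⇔ to from
  where
  to : Matroid.Basis (catalan n) S → Σ (DyckPath n) λ P → S ≡ upSteps P
  to (_ , (P , S⊆) , max) = P , ⊆-antisym S⊆ λ {e} e∈ → decidable-stable (e ∈? S) λ e∉S →
    max e ∈⊤ e∉S (P , λ i∈ → case-∪ e∈ (x∈p∪q⁻ S ⁅ e ⁆ i∈))
    where
    case-∪ : ∀ {e i} → e ∈ upSteps P → i ∈ S ⊎ i ∈ ⁅ e ⁆ → i ∈ upSteps P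
    case-∪ e∈ (inj₁ i∈S) = S⊆ i∈S
    case-∪ {e} e∈ (inj₂ i∈e) = subst (_∈ upSteps P) (sym (x∈⁅y⁆⇒x≡y e i∈e)) e∈
  from : (Σ (DyckPath n) λ P → S ≡ upSteps P) → Matroid.Basis (catalan n) S
  from (P , refl) = ⊆⊤ , (P , λ x → x) , λ e _ e∉ (Q , ∪⊆) → <-irrefl
    (trans (upSteps-size n P) (sym (upSteps-size n Q)))
    (p⊂q⇒∣p∣<∣q∣
      ((λ i∈ → ∪⊆ (x∈p∪q⁺ (inj₁ i∈))) , e , ∪⊆ (x∈p∪q⁺ (inj₂ (x∈⁅x⁆ e))) , e∉))

{-# OPTIONS --safe #-}

-- Contracting the first n − 2 elements of C_n and deleting the elements
-- 2n − 2 and 2n leaves the uniform matroid U_{2,n}: any two further up-steps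
-- among n − 1, …, 2n − 3, 2n − 1 complete n − 2 initial up-steps to a Dyck path.
-- Over a field with q elements, U_{2,n} asks for n pairwise independent vectors
-- in a plane.  In coordinates with respect to two of them, x and y, every
-- vector other than x has a nonzero y-coordinate, and the n − 1 ratios of the
-- two coordinates are distinct elements of the field, so n − 1 ≤ q.

module Submission where

open import Algebra.Bundles using (CommutativeRing)
open import Algebra.Module.Bundles using (Module)
import Algebra.Properties.CommutativeMonoid.Sum
import Algebra.Properties.Ring
open import Data.Fin.Base using (Fin; zero; suc; _↑ʳ_)
import Data.Fin.Properties as Fin
open import Data.Fin.Permutation using (Permutation; _⟨$⟩ʳ_; _⟨$⟩ˡ_; inverseˡ; inverseʳ)
open import Data.Fin.Subset using
  (Subset; inside; outside; ⊥; ⁅_⁆; _∈_; _∉_; _⊆_; _∪_; ∣_∣)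
open import Data.Fin.Subset.Properties using
  (x∈p∪q⁺; x∈p∪q⁻; x∈⁅x⁆; x∈⁅y⁆⇒x≡y; ⊆-antisym; p⊆q⇒∣p∣≤∣q∣; ∪-identityʳ;
   ∪-identityˡ; ∪-comm; ∣⊥∣≡0; ∣⁅x⁆∣≡1; ∉⊥; drop-there)
open import Data.Nat.Base using (ℕ; zero; suc; _+_; _*_; _≤_; z≤n; s≤s; s≤s⁻¹)
open import Data.Nat.Properties using
  (≤-trans; ≤-reflexive; n≤1+n; +-comm; +-identityʳ; +-monoʳ-≤; m≤n+m; *-monoʳ-≤; 1+n≰n; module ≤-Reasoning)
open import Data.Nat.Solver using (module +-*-Solver)
open import Data.Product.Base using (_,_; proj₁; proj₂)
open import Data.Sum.Base using (inj₁; inj₂; [_,_]′)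
open import Data.Unit.Base using (tt)
open import Data.Vec.Base using ([]; _∷_; _++_; replicate; here; there)
open import Data.Vec.Properties using ([]=⇒lookup; lookup⇒[]=; lookup∘tabulate)
open import Function.Base using (_∘_)
open import Function.Bundles using (Equivalence; Inverse)
open import Function.Definitions using (Injective)
import Relation.Binary.Reasoning.Setoid
open import Relation.Binary.PropositionalEquality
  using (_≡_; _≢_; refl; sym; trans; cong; subst)
open import Relation.Nullary using (¬_; yes; no; contradiction)
open import Defs

-- Images of subsets under a bijection, and line minors under isomorphism.

∈-image⁺ : ∀ {m n} (σ : Permutation m n) S {j} → σ ⟨$⟩ˡ j ∈ S → j ∈ image σ S
∈-image⁺ σ S {j} j∈ =
  lookup⇒[]= j _ (trans (lookup∘tabulate _ j) ([]=⇒lookup j∈))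

∈-image⁻ : ∀ {m n} (σ : Permutation m n) S {j} → j ∈ image σ S → σ ⟨$⟩ˡ j ∈ S
∈-image⁻ σ S {j} j∈ =
  lookup⇒[]= _ S (trans (sym (lookup∘tabulate _ j)) ([]=⇒lookup j∈))

image-∪⁅⁆ : ∀ {m n} (σ : Permutation m n) S x →
            image σ (S ∪ ⁅ x ⁆) ≡ image σ S ∪ ⁅ σ ⟨$⟩ʳ x ⁆
image-∪⁅⁆ σ S x = ⊆-antisym to from
  where
  to : image σ (S ∪ ⁅ x ⁆) ⊆ image σ S ∪ ⁅ σ ⟨$⟩ʳ x ⁆
  to {j} j∈ with x∈p∪q⁻ S ⁅ x ⁆ (∈-image⁻ σ (S ∪ ⁅ x ⁆) j∈)
  ... | inj₁ ∈S = x∈p∪q⁺ (inj₁ (∈-image⁺ σ S ∈S))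
  ... | inj₂ ∈x = x∈p∪q⁺ (inj₂ (subst (_∈ ⁅ σ ⟨$⟩ʳ x ⁆)
    (trans (cong (σ ⟨$⟩ʳ_) (sym (x∈⁅y⁆⇒x≡y x ∈x))) (inverseʳ σ)) (x∈⁅x⁆ _)))
  from : image σ S ∪ ⁅ σ ⟨$⟩ʳ x ⁆ ⊆ image σ (S ∪ ⁅ x ⁆)
  from {j} j∈ with x∈p∪q⁻ (image σ S) ⁅ σ ⟨$⟩ʳ x ⁆ j∈
  ... | inj₁ ∈S = ∈-image⁺ σ (S ∪ ⁅ x ⁆) (x∈p∪q⁺ (inj₁ (∈-image⁻ σ S ∈S)))
  ... | inj₂ ∈x = ∈-image⁺ σ (S ∪ ⁅ x ⁆) (x∈p∪q⁺ (inj₂ (subst (_∈ ⁅ x ⁆)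
    (trans (sym (inverseˡ σ)) (cong (σ ⟨$⟩ˡ_) (sym (x∈⁅y⁆⇒x≡y _ ∈x)))) (x∈⁅x⁆ x))))

-- A minor of M isomorphic to U_{2,k}: contract the elements of base, then
-- restrict to the image of point.
record LineMinor {n ℓ} (M : Matroid n ℓ) (k : ℕ) : Set ℓ where
  open Matroid M
  field
    base      : Subset n
    point     : Fin k → Fin n
    injective : Injective _≡_ _≡_ point
    point∉    : ∀ i → point i ∉ base
    pair      : ∀ i j → i ≢ j → Independent ((base ∪ ⁅ point i ⁆) ∪ ⁅ point j ⁆)
    triple    : ∀ i j l → i ≢ j → l ≢ i → l ≢ j →
                ¬ Independent (((base ∪ ⁅ point i ⁆) ∪ ⁅ point j ⁆) ∪ ⁅ point l ⁆)

-- `independent⇔` is used forwards for `pair` and backwards for `triple`; `image-∪⁅⁆` brings the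
-- images to the iterated unions that `LineMinor` asks for.
lineMinor-≅ : ∀ {m n ℓ₁ ℓ₂ k} {M : Matroid m ℓ₁} {N : Matroid n ℓ₂} →
              M ≅ N → LineMinor M k → LineMinor N k
lineMinor-≅ {M = M} {N} M≅N L = record
  { base      = image σ base
  ; point     = λ i → σ ⟨$⟩ʳ point i
  ; injective = λ e → injective (trans (sym (inverseˡ σ)) (trans (cong (σ ⟨$⟩ˡ_) e) (inverseˡ σ)))
  ; point∉    = λ i i∈ → point∉ i (subst (_∈ base) (inverseˡ σ) (∈-image⁻ σ base i∈))
  ; pair      = λ i j i≢j → subst (Matroid.Independent N) (image₂ i j)
                  (Equivalence.to (independent⇔ _) (pair i j i≢j))
  ; triple    = λ i j l i≢j l≢i l≢j ind → triple i j l i≢j l≢i l≢j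
                  (Equivalence.from (independent⇔ _)
                    (subst (Matroid.Independent N) (sym (image₃ i j l)) ind))
  }
  where
  open _≅_ M≅N renaming (bijection to σ)
  open LineMinor L
  image₂ : ∀ i j → image σ ((base ∪ ⁅ point i ⁆) ∪ ⁅ point j ⁆) ≡
                   (image σ base ∪ ⁅ σ ⟨$⟩ʳ point i ⁆) ∪ ⁅ σ ⟨$⟩ʳ point j ⁆
  image₂ i j = trans (image-∪⁅⁆ σ (base ∪ ⁅ point i ⁆) _) (cong (_∪ _) (image-∪⁅⁆ σ base _))
  image₃ : ∀ i j l → image σ (((base ∪ ⁅ point i ⁆) ∪ ⁅ point j ⁆) ∪ ⁅ point l ⁆) ≡
                     ((image σ base ∪ ⁅ σ ⟨$⟩ʳ point i ⁆) ∪ ⁅ σ ⟨$⟩ʳ point j ⁆) ∪ ⁅ σ ⟨$⟩ʳ point l ⁆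
  image₃ i j l = trans (image-∪⁅⁆ σ ((base ∪ ⁅ point i ⁆) ∪ ⁅ point j ⁆) _) (cong (_∪ _) (image₂ i j))

-- Line minors of vector matroids over a finite field.

module _ {c ℓ μ ν} (F : Field c ℓ) (V : VectorSpace F μ ν) {m : ℕ}
         (v : Fin m → Module.Carrierᴹ V) where

  open Field F
  private
    module R = CommutativeRing commutativeRing
    module ≈-R = Relation.Binary.Reasoning.Setoid R.setoid
    LI = LinearlyIndependent F V v
    comb = combination F V v
  open R using (Carrier; _≈_; _≉_; 0#; 1#)
    renaming (_+_ to _⊕_; _*_ to _·_; -_ to ⊖_)
  open Module V
  open Algebra.Properties.CommutativeMonoid.Sum +ᴹ-commutativeMonoid using (sum-cong-≋)
  open Algebra.Properties.Ring R.ring using (-0#≈0#; -‿involutive)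

  combination-cong : ∀ {x y} → (∀ i → x i ≈ y i) → comb x ≈ᴹ comb y
  combination-cong x≈y = sum-cong-≋ λ i → *ₗ-congʳ (x≈y i)

  span-⊆ : ∀ {S T w} → S ⊆ T → Span F V v S w → Span F V v T w
  span-⊆ S⊆T = span-trans F V v λ i i∈S → span-v F V v i (S⊆T i∈S)

  supportedOn-∪⁅⁆ : ∀ {S e x} → SupportedOn F V v (S ∪ ⁅ e ⁆) x → x e ≈ 0# →
                    SupportedOn F V v S x
  supportedOn-∪⁅⁆ {e = e} s xₑ≈0 i i∉S with i Fin.≟ e
  ... | yes refl = xₑ≈0
  ... | no  i≢e  = s i (∉-∪-⁅⁆ F V v i∉S i≢e)

  -- Moving `v e` to the other side gives a relation supported on `S ∪ ⁅ e ⁆`. Since `e ∉ S`, its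
  -- coefficient at `e` is exactly -1, and independence would force this to be 0.
  independent⇒¬span : ∀ {S e} → e ∉ S → LI (S ∪ ⁅ e ⁆) → ¬ Span F V v S (v e)
  independent⇒¬span {S} {e} e∉S li (x , s , eq) = 1≉0 (begin
    1#                          ≈⟨ -‿involutive 1# ⟨
    ⊖ (⊖ 1#)                    ≈⟨ R.-‿cong (R.*-identityʳ _) ⟨
    ⊖ ((⊖ 1#) · 1#)             ≈⟨ R.-‿cong (R.+-identityˡ _) ⟨
    ⊖ (0# ⊕ (⊖ 1#) · 1#)        ≈⟨ R.-‿cong (R.+-cong (s e e∉S) (R.*-congˡ (δ-≡ F V v e))) ⟨
    ⊖ y e                       ≈⟨ R.-‿cong (li y supp (relation F V v e x eq) e) ⟩
    ⊖ 0#                        ≈⟨ -0#≈0# ⟩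
    0#                          ∎)
    where
    open ≈-R
    y : Fin m → Carrier
    y j = x j ⊕ (⊖ 1#) · δ F V v e j
    supp : SupportedOn F V v (S ∪ ⁅ e ⁆) y
    supp j j∉ = R.trans
      (R.+-cong (s j (j∉ ∘ x∈p∪q⁺ ∘ inj₁))
        (R.trans (R.*-congˡ (δ-≢ F V v {i = e} {j} λ { refl → j∉ (x∈p∪q⁺ (inj₂ (x∈⁅x⁆ j))) })) (R.zeroʳ _)))
      (R.+-identityˡ 0#)

  vectorMatroid-lineMinor : ∀ {q k} → HasOrder F q → LineMinor (vectorMatroid F V v) k →
                            ¬ q + 2 ≤ k
  vectorMatroid-lineMinor {q} {k} order L q+2≤k with k | subst (_≤ k) (+-comm q 2) q+2≤k | L
  -- From here on there are `k + 2` points and `q ≤ k`. A failure of independence yields membership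
  -- in a span only under double negation; this suffices because the goal is a contradiction and the
  -- points are finitely many.
  ... | suc (suc k) | s≤s (s≤s q≤k) | L = ¬¬-Fin spanned coincidence
    where
    open LineMinor L
    x₀ = point zero
    z : Fin (suc k) → Fin m
    z = point ∘ suc
    y₀ = z zero
    B = (base ∪ ⁅ x₀ ⁆) ∪ ⁅ y₀ ⁆

    ∉-∪ : ∀ i j → i ≢ j → point i ∉ base ∪ ⁅ point j ⁆
    ∉-∪ i j i≢j = ∉-∪-⁅⁆ F V v (point∉ i) (i≢j ∘ injective)

    spanned : ∀ i → ¬ ¬ Span F V v B (v (z i))
    spanned zero    ¬span = ¬span (span-v F V v y₀ (x∈p∪q⁺ (inj₂ (x∈⁅x⁆ y₀))))
    spanned (suc i) = dependent⇒span F V v (z (suc i)) (pair zero (suc zero) λ ())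
      (triple zero (suc zero) (suc (suc i)) (λ ()) (λ ()) (λ ()))

    -- Two points with equal ratios are parallel modulo the span of `base`, against the independence
    -- of the pair that they form.
    coincidence : ¬ (∀ i → Span F V v B (v (z i)))
    coincidence spans = independent⇒¬span (∉-∪ (suc j) (suc i) (i≢j ∘ sym ∘ Fin.suc-injective))
      (pair (suc i) (suc j) (i≢j ∘ Fin.suc-injective)) span-zⱼ
      where
      x : ∀ i → Fin m → Carrier
      x i = proj₁ (spans i)
      s : ∀ i → SupportedOn F V v B (x i)
      s i = proj₁ (proj₂ (spans i))
      e : ∀ i → v (z i) ≈ᴹ comb (x i)
      e i = proj₂ (proj₂ (spans i))
      α β β⁻¹ ratio : Fin (suc k) → Carrier
      -- Only these two coordinates are compared; the coefficients on `base` may differ freely,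
      -- which amounts to working modulo its span.
      α i = x i x₀
      β i = x i y₀
      β≉0 : ∀ i → β i ≉ 0#
      -- Without a `y₀`-coordinate, `v (z i)` would lie in the span of `base ∪ ⁅ x₀ ⁆`.
      β≉0 i β≈0 = independent⇒¬span (∉-∪ (suc i) zero λ ()) (pair zero (suc i) λ ())
        (x i , supportedOn-∪⁅⁆ (s i) β≈0 , e i)
      β⁻¹ i = proj₁ (invertible (β i) (β≉0 i))
      β⁻¹·β : ∀ i → β⁻¹ i · β i ≈ 1#
      β⁻¹·β i = proj₁ (proj₂ (invertible (β i) (β≉0 i)))
      ratio i = α i · β⁻¹ i

      -- Leaving out only `x₀` keeps `k + 1` ratios, one more than `k` and hence more than the `q`
      -- elements of the field.
      collision = Fin.pigeonhole (s≤s q≤k) (Inverse.to order ∘ ratio)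
      i = proj₁ collision
      j = proj₁ (proj₂ collision)
      i≢j : i ≢ j
      i≢j = Fin.<⇒≢ (proj₁ (proj₂ (proj₂ collision)))
      ratio≈ : ratio i ≈ ratio j
      ratio≈ = R.trans (R.sym (Inverse.strictlyInverseʳ order (ratio i)))
        (R.trans (Inverse.from-cong order (proj₂ (proj₂ (proj₂ collision))))
          (Inverse.strictlyInverseʳ order (ratio j)))

      -- The scalar that matches the `y₀`-coordinates; equality of the ratios makes it match the
      -- `x₀`-coordinates as well.
      ρ = β j · β⁻¹ i
      β-eq : ρ · β i ≈ β j
      β-eq = begin
        (β j · β⁻¹ i) · β i  ≈⟨ R.*-assoc _ _ _ ⟩
        β j · (β⁻¹ i · β i)  ≈⟨ R.*-congˡ (β⁻¹·β i) ⟩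
        β j · 1#             ≈⟨ R.*-identityʳ _ ⟩
        β j                  ∎
        where open ≈-R
      α-eq : ρ · α i ≈ α j
      α-eq = begin
        (β j · β⁻¹ i) · α i  ≈⟨ R.*-assoc _ _ _ ⟩
        β j · (β⁻¹ i · α i)  ≈⟨ R.*-congˡ (R.*-comm _ _) ⟩
        β j · ratio i        ≈⟨ R.*-congˡ ratio≈ ⟩
        β j · ratio j        ≈⟨ R.*-comm _ _ ⟩
        (α j · β⁻¹ j) · β j  ≈⟨ R.*-assoc _ _ _ ⟩
        α j · (β⁻¹ j · β j)  ≈⟨ R.*-congˡ (β⁻¹·β j) ⟩
        α j · 1#             ≈⟨ R.*-identityʳ _ ⟩
        α j                  ∎
        where open ≈-R

      y : Fin m → Carrier
      -- The difference of the two coordinate vectors after scaling by `ρ`. It vanishes off `B`, at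
      -- `y₀` and at `x₀`, so only `base` is left, and `v (z j)` becomes `ρ *ₗ v (z i)` plus an
      -- element of the span of `base`.
      y l = x j l ⊕ ⊖ (ρ · x i l)
      vanishes : ∀ {l} → ρ · x i l ≈ x j l → y l ≈ 0#
      vanishes eq = R.trans (R.+-congˡ (R.-‿cong eq)) (R.-‿inverseʳ _)
      y-supp : SupportedOn F V v base y
      y-supp = supportedOn-∪⁅⁆ (supportedOn-∪⁅⁆
        (λ l l∉ → vanishes (R.trans (R.*-congˡ (s i l l∉)) (R.trans (R.zeroʳ ρ) (R.sym (s j l l∉)))))
        (vanishes β-eq)) (vanishes α-eq)
      x≈y+ρx : ∀ l → x j l ≈ y l ⊕ ρ · x i l
      x≈y+ρx l = begin
        x j l                                   ≈⟨ R.+-identityʳ _ ⟨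
        x j l ⊕ 0#                              ≈⟨ R.+-congˡ (R.-‿inverseˡ _) ⟨
        x j l ⊕ (⊖ (ρ · x i l) ⊕ ρ · x i l)     ≈⟨ R.+-assoc _ _ _ ⟨
        y l ⊕ ρ · x i l                         ∎
        where open ≈-R
      zⱼ≈ : comb y +ᴹ ρ *ₗ v (z i) ≈ᴹ v (z j)
      zⱼ≈ = begin
        comb y +ᴹ ρ *ₗ v (z i)            ≈⟨ +ᴹ-cong ≈ᴹ-refl (*ₗ-congˡ (e i)) ⟩
        comb y +ᴹ ρ *ₗ comb (x i)         ≈⟨ +ᴹ-cong ≈ᴹ-refl (combination-* F V v ρ (x i)) ⟨
        comb y +ᴹ comb (λ l → ρ · x i l)  ≈⟨ combination-+ F V v _ _ ⟨
        comb (λ l → y l ⊕ ρ · x i l)      ≈⟨ combination-cong x≈y+ρx ⟨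
        comb (x j)                        ≈⟨ e j ⟨
        v (z j)                           ∎
        where open Relation.Binary.Reasoning.Setoid ≈ᴹ-setoid
      span-zⱼ : Span F V v (base ∪ ⁅ z i ⁆) (v (z j))
      span-zⱼ = span-≈ F V v zⱼ≈ (span-+ F V v
        (span-⊆ (x∈p∪q⁺ ∘ inj₁) (y , y-supp , ≈ᴹ-refl))
        (span-* F V v ρ (span-v F V v (z i) (x∈p∪q⁺ (inj₂ (x∈⁅x⁆ (z i)))))))

-- Sparse subsets made of an initial run and two late points.

∣p∪⁅x⁆∣≡ : ∀ {n} {p : Subset n} {x} → x ∉ p → ∣ p ∪ ⁅ x ⁆ ∣ ≡ suc ∣ p ∣
∣p∪⁅x⁆∣≡ {p = inside ∷ p} {zero}  x∉ = contradiction here x∉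
∣p∪⁅x⁆∣≡ {p = outside ∷ p} {zero}  x∉ = cong (suc ∘ ∣_∣) (∪-identityʳ p)
∣p∪⁅x⁆∣≡ {p = inside ∷ p} {suc x} x∉ = cong suc (∣p∪⁅x⁆∣≡ (x∉ ∘ there))
∣p∪⁅x⁆∣≡ {p = outside ∷ p} {suc x} x∉ = ∣p∪⁅x⁆∣≡ (x∉ ∘ there)

sparse-size : ∀ {k} {S : Subset k} → Sparse S → 2 * ∣ S ∣ ≤ k
sparse-size {S = []}    _       = z≤n
sparse-size {S = _ ∷ _} (h , _) = h

sparse-outside : ∀ {k} {S : Subset k} → Sparse S → Sparse (outside ∷ S)
sparse-outside sp = ≤-trans (sparse-size sp) (n≤1+n _) , sp

sparse-⊥ : ∀ k → Sparse {k} ⊥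
sparse-⊥ zero    = tt
sparse-⊥ (suc k) = sparse-outside (sparse-⊥ k)

∣prefix∣ : ∀ {k} p {S : Subset k} → ∣ replicate p inside ++ S ∣ ≡ p + ∣ S ∣
∣prefix∣ zero    = refl
∣prefix∣ (suc p) = cong suc (∣prefix∣ p)

-- Dropping a leading element of the run lowers twice the size by 2 and the length by only 1, so the
-- bound for the whole set passes to every suffix that starts inside the run.
sparse-prefix : ∀ {k} p {S : Subset k} → 2 * (p + ∣ S ∣) ≤ p + k → Sparse S →
                Sparse (replicate p inside ++ S)
sparse-prefix zero    _ sp = sp
sparse-prefix {k} (suc p) {S} le sp =
  subst (λ s → 2 * s ≤ suc p + k) (sym (∣prefix∣ (suc p) {S})) le ,
  sparse-prefix p (≤-trans (n≤1+n _) (s≤s⁻¹ (subst (_≤ suc p + k) (up-shift 0 (p + ∣ S ∣)) le))) sp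

prefix-∪⁅⁆ : ∀ {k} p (S : Subset k) x →
             (replicate p inside ++ S) ∪ ⁅ p ↑ʳ x ⁆ ≡ replicate p inside ++ (S ∪ ⁅ x ⁆)
prefix-∪⁅⁆ zero    S x = refl
prefix-∪⁅⁆ (suc p) S x = cong (inside ∷_) (prefix-∪⁅⁆ p S x)

↑ʳ-∉ : ∀ {k} p {S : Subset k} {x} → x ∉ S → p ↑ʳ x ∉ replicate p inside ++ S
↑ʳ-∉ zero    x∉ = x∉
↑ʳ-∉ (suc p) x∉ = ↑ʳ-∉ p x∉ ∘ drop-there

-- The values of late n are 0, …, n − 2 and n.
late : ∀ n → Fin n → Fin (n + 2)
late (suc zero)    zero    = suc zero
late (suc (suc n)) zero    = zero
late (suc (suc n)) (suc i) = suc (late (suc n) i)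

late-injective : ∀ n → Injective _≡_ _≡_ (late n)
late-injective (suc zero)    {zero}  {zero}  _  = refl
late-injective (suc (suc n)) {zero}  {zero}  _  = refl
late-injective (suc (suc n)) {suc i} {suc j} eq =
  cong suc (late-injective (suc n) (Fin.suc-injective eq))

sparse-late : ∀ n i → Sparse ⁅ late n i ⁆
sparse-late (suc zero)    zero    = s≤s (s≤s z≤n) , s≤s (s≤s z≤n) , z≤n , tt
sparse-late (suc (suc n)) zero    =
  subst (λ s → 2 * suc s ≤ suc (suc n) + 2) (sym (∣⊥∣≡0 (suc n + 2))) (s≤s (s≤s z≤n)) , sparse-⊥ _
sparse-late (suc (suc n)) (suc i) = sparse-outside (sparse-late (suc n) i)

-- The tight cases are the value `n`, alone in a suffix of length 2, and the values `n - 2` and `n`,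
-- which are half of the last 4 positions. The value `n - 1` is skipped because together with `n` it
-- would put two elements into a suffix of length 3, and `n + 1` because it would fill a suffix of
-- length 1.
sparse-late-pair : ∀ n i j → i ≢ j → Sparse (⁅ late n i ⁆ ∪ ⁅ late n j ⁆)
sparse-late-pair (suc zero)    zero    zero    i≢j = contradiction refl i≢j
sparse-late-pair (suc (suc n)) zero    zero    i≢j = contradiction refl i≢j
sparse-late-pair (suc (suc n)) zero    (suc j) _   =
  subst (Sparse ∘ (inside ∷_)) (sym (∪-identityˡ _))
    ( subst (λ s → 2 * suc s ≤ _) (sym (∣⁅x⁆∣≡1 (late (suc n) j))) (s≤s (s≤s (m≤n+m 2 n)))
    , sparse-late (suc n) j )
sparse-late-pair (suc (suc n)) (suc i) zero    i≢j =
  subst Sparse (∪-comm ⁅ zero ⁆ ⁅ suc (late (suc n) i) ⁆) (sparse-late-pair (suc (suc n)) zero (suc i) (i≢j ∘ sym))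
sparse-late-pair (suc (suc n)) (suc i) (suc j) i≢j =
  sparse-outside (sparse-late-pair (suc n) i j (i≢j ∘ cong suc))

-- The length k is kept apart from the sum because the ground set of the
-- Catalan matroid has the only propositionally equal size 2 * (2 + p).
record SparseLine (p k : ℕ) : Set where
  field
    base      : Subset k
    ∣base∣    : ∣ base ∣ ≡ p
    point     : Fin (2 + p) → Fin k
    injective : Injective _≡_ _≡_ point
    point∉    : ∀ i → point i ∉ base
    pair      : ∀ i j → i ≢ j → Sparse ((base ∪ ⁅ point i ⁆) ∪ ⁅ point j ⁆)

sparseLine : ∀ {k} p → p + (2 + p + 2) ≡ k → SparseLine p k
sparseLine p refl = record
  { base      = replicate p inside ++ ⊥
  ; ∣base∣    = trans (∣prefix∣ p) (trans (cong (p +_) (∣⊥∣≡0 (2 + p + 2))) (+-identityʳ p))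
  ; point     = λ i → p ↑ʳ late (2 + p) i
  ; injective = late-injective (2 + p) ∘ Fin.↑ʳ-injective p _ _
  ; point∉    = λ i → ↑ʳ-∉ p ∉⊥
  ; pair      = λ i j i≢j → subst Sparse (sym (shape i j))
                  (sparse-prefix p (size i j) (sparse-late-pair (2 + p) i j i≢j))
  }
  where
  ℓ = late (2 + p)
  shape : ∀ i j → ((replicate p inside ++ ⊥) ∪ ⁅ p ↑ʳ ℓ i ⁆) ∪ ⁅ p ↑ʳ ℓ j ⁆ ≡
                  replicate p inside ++ (⁅ ℓ i ⁆ ∪ ⁅ ℓ j ⁆)
  shape i j = trans (cong (_∪ ⁅ p ↑ʳ ℓ j ⁆) (prefix-∪⁅⁆ p ⊥ (ℓ i)))
    (trans (prefix-∪⁅⁆ p (⊥ ∪ ⁅ ℓ i ⁆) (ℓ j))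
      (cong (λ S → replicate p inside ++ (S ∪ ⁅ ℓ j ⁆)) (∪-identityˡ ⁅ ℓ i ⁆)))
  double : ∀ p → 2 * (p + 2) ≡ p + (2 + p + 2)
  double = solve 1 (λ p → con 2 :* (p :+ con 2) := p :+ (con 2 :+ p :+ con 2)) refl
    where open +-*-Solver
  size : ∀ i j → 2 * (p + ∣ ⁅ ℓ i ⁆ ∪ ⁅ ℓ j ⁆ ∣) ≤ p + (2 + p + 2)
  -- At most `p + 2` elements lie among `2 * (p + 2)` positions, so the bound holds with nothing to
  -- spare.
  size i j = ≤-trans
    (*-monoʳ-≤ 2 (+-monoʳ-≤ p (≤-trans (∣p∪⁅x⁆∣≤ ⁅ ℓ i ⁆ (ℓ j)) (s≤s (≤-reflexive (∣⁅x⁆∣≡1 (ℓ i)))))))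
    (≤-reflexive (double p))

-- A line minor of the Catalan matroid.

-- A sparse set of at most `2 + p` elements extends to the up-step set of a Dyck path, which settles
-- `pair`. For `triple` counting is enough: it has `3 + p` elements, while each path has `2 + p`
-- up-steps.
catalan-lineMinor : ∀ p → LineMinor (catalan (2 + p)) (2 + p)
catalan-lineMinor p = record
  { base      = base
  ; point     = point
  ; injective = injective
  ; point∉    = point∉
  ; pair      = λ i j i≢j → extend _ 0 (2 + p) refl (≤-reflexive (size i j i≢j)) (pair i j i≢j)
  ; triple    = λ i j l i≢j l≢i l≢j (P , S⊆) → 1+n≰n (begin
      suc (2 + p)                                                       ≡⟨ cong suc (size i j i≢j) ⟨
      suc ∣ (base ∪ ⁅ point i ⁆) ∪ ⁅ point j ⁆ ∣                        ≡⟨ ∣p∪⁅x⁆∣≡ (∉-∪ l≢j (∉-∪ l≢i (point∉ l))) ⟨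
      ∣ ((base ∪ ⁅ point i ⁆) ∪ ⁅ point j ⁆) ∪ ⁅ point l ⁆ ∣            ≤⟨ p⊆q⇒∣p∣≤∣q∣ S⊆ ⟩
      ∣ upSteps P ∣                                                     ≡⟨ upSteps-size (2 + p) P ⟩
      2 + p                                                             ∎)
  }
  where
  open ≤-Reasoning
  length≡ : ∀ p → p + (2 + p + 2) ≡ 2 * (2 + p)
  length≡ = solve 1 (λ p → p :+ (con 2 :+ p :+ con 2) := con 2 :* (con 2 :+ p)) refl
    where open +-*-Solver
  open SparseLine (sparseLine p (length≡ p))
  ∉-∪ : ∀ {S i j} → i ≢ j → point i ∉ S → point i ∉ S ∪ ⁅ point j ⁆
  ∉-∪ {S} {i} {j} i≢j i∉S i∈ = [ i∉S , i≢j ∘ injective ∘ x∈⁅y⁆⇒x≡y (point j) ]′ (x∈p∪q⁻ S _ i∈)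
  size : ∀ i j → i ≢ j → ∣ (base ∪ ⁅ point i ⁆) ∪ ⁅ point j ⁆ ∣ ≡ 2 + p
  size i j i≢j = trans (∣p∪⁅x⁆∣≡ (∉-∪ (i≢j ∘ sym) (point∉ j)))
    (cong suc (trans (∣p∪⁅x⁆∣≡ (point∉ i)) (cong suc ∣base∣)))

proposition5p3 : ∀ {c ℓ} μ ν (n : ℕ) → 1 ≤ n →
    (q : ℕ) (F : Field c ℓ) → HasOrder F q → q + 2 ≤ n →
    ¬ Representable μ ν F (catalan n)
-- The bound `q + 2 ≤ n` rules out `n = 1`; otherwise `p = n - 2` is the number of contracted
-- elements.
proposition5p3 μ ν (suc zero) _ q F order q+2≤1 _ =
  contradiction (≤-trans (m≤n+m 2 q) q+2≤1) λ { (s≤s ()) }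
proposition5p3 μ ν (suc (suc p)) _ q F order q+2≤n (V , m , v , C≅) =
  vectorMatroid-lineMinor F V v order (lineMinor-≅ C≅ (catalan-lineMinor p)) q+2≤n
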